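{- There exist absolute constants $c_0>0$ and $n_0$ such that for every $n\ge n_0$ for which $\sqrt n$ is an even integer, there exist a read-once DNF formula $f:\{0,1\}^n\to\{0,1\}$ and a probability vector $p\in(0,1)^n$ such that, under unit costs ($c_i=1$ for all $i$), $$\mathsf{OPT}_{\mathcal N}(f,c,p)\ge c_0\sqrt{n}\cdot \mathsf{OPT}_{\mathcal A}(f,c,p).$$
   Context: Stochastic Boolean Function Evaluation (SBFE) setup: $f:\{0,1\}^n\to\{0,1\}$ is a known Boolean function, $c\in\mathbb{R}_{>0}^n$ a cost vector and $p\in(0,1)^n$ a probability vector. The unknown input $x\in\{0,1\}^n$ is random with independent coordinates and $\Pr(x_i=1)=p_i$. The value $x_i$ can only be learned by testing variable $i$, at cost $c_i$. A strategy tests variables sequentially until $f(x)$ is determined, i.e. until $f(x')=f(x)$ for every $x'$ agreeing with $x$ on all tested coordinates. An adaptive strategy is a decision tree (the next test may depend on previous outcomes); a non-adaptive strategy is a fixed permutation of $[n]$, with variables tested in that order until $f(x)$ is determined. $\mathrm{cost}_{c,p}(f,S)$ is the expected total cost of tests performed by $S$ for random $x$. $\mathsf{OPT}_{\mathcal A}(f,c,p)$ (resp. $\mathsf{OPT}_{\mathcal N}(f,c,p)$) is the minimum of $\mathrm{cost}_{c,p}(f,S)$ over all adaptive (resp. non-adaptive) strategies. A DNF formula is a disjunction of terms, each a conjunction of literals; it is read-once if no variable is negated and distinct terms contain disjoint sets of variables. -}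

module Defs where

open import Data.Bool using (Bool; true; false; not; if_then_else_)
open import Data.Bool.ListAction using (all; any)
open import Data.Bool.Properties using () renaming (_≟_ to _≟ᵇ_)
open import Data.Fin using (Fin)
open import Data.Fin.Permutation using (Permutation′; _⟨$⟩ʳ_)
open import Data.Fin.Properties using (all?)
open import Data.Integer using (+_)
open import Data.List as List using (List; []; _∷_; _++_)
open import Data.List.NonEmpty as List⁺ using (List⁺)
open import Data.List.Relation.Binary.Disjoint.Propositional using (Disjoint)
open import Data.List.Relation.Unary.All using (All)
open import Data.List.Relation.Unary.AllPairs using (AllPairs)
open import Data.Maybe using (Maybe; just; nothing)
import Data.Maybe.Relation.Unary.All as Maybe
open import Data.Nat using (ℕ; zero; suc)
open import Data.Product using (_×_; _,_; ∃-syntax)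
open import Data.Rational using (ℚ; 0ℚ; 1ℚ; _+_; _*_; _-_; _≤_; _<_; _/_)
open import Data.Vec using (Vec; []; _∷_; lookup; replicate; _[_]≔_)
open import Relation.Binary.PropositionalEquality using (_≡_)
open import Relation.Nullary using (¬_; Dec; does)
open import Relation.Nullary.Decidable using (map′; _×-dec_; _→-dec_)
open import Relation.Unary using (Decidable)

Input : ℕ → Set
Input n = Vec Bool n

BoolFun : ℕ → Set
BoolFun n = Input n → Bool

ℕ→ℚ : ℕ → ℚ
ℕ→ℚ k = + k / 1

data Literal (n : ℕ) : Set where
  pos neg : Fin n → Literal n

-- Terms and formulas are non-empty. Otherwise the empty disjunction (or an empty
-- conjunction) would be a constant function, which every strategy evaluates at cost 0.
Term : ℕ → Set
Term n = List⁺ (Literal n)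

DNF : ℕ → Set
DNF n = List⁺ (Term n)

evalLiteral : ∀ {n} → Literal n → Input n → Bool
evalLiteral (pos i) x = lookup x i
evalLiteral (neg i) x = not (lookup x i)

evalTerm : ∀ {n} → Term n → Input n → Bool
evalTerm t x = all (λ l → evalLiteral l x) (List⁺.toList t)

⟦_⟧ : ∀ {n} → DNF n → BoolFun n
⟦ φ ⟧ x = any (λ t → evalTerm t x) (List⁺.toList φ)

data Positive {n : ℕ} : Literal n → Set where
  isPos : ∀ i → Positive (pos i)

var : ∀ {n} → Literal n → Fin n
var (pos i) = i
var (neg i) = i

vars : ∀ {n} → Term n → List (Fin n)
vars t = List.map var (List⁺.toList t)

ReadOnce : ∀ {n} → DNF n → Set
ReadOnce φ =
    All (λ t → All Positive (List⁺.toList t)) (List⁺.toList φ)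
  × AllPairs (λ t u → Disjoint (vars t) (vars u)) (List⁺.toList φ)

-- What is known after some tests: `just b` is the outcome of a performed test,
-- `nothing` marks an untested variable.
Knowledge : ℕ → Set
Knowledge n = Vec (Maybe Bool) n

noTests : ∀ {n} → Knowledge n
noTests = replicate _ nothing

Agrees : ∀ {n} → Knowledge n → Input n → Set
Agrees ρ x = ∀ i → Maybe.All (lookup x i ≡_) (lookup ρ i)

Determined : ∀ {n} → BoolFun n → Knowledge n → Set
Determined f ρ = ∀ x x′ → Agrees ρ x → Agrees ρ x′ → f x′ ≡ f x

allInputs? : ∀ {n} {P : Input n → Set} → Decidable P → Dec (∀ x → P x)
allInputs? {zero}  P? = map′ (λ { p [] → p }) (λ p → p []) (P? [])
allInputs? {suc n} P? =
  map′ (λ { (p , q) (false ∷ x) → p x ; (p , q) (true ∷ x) → q x })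
       (λ p → (λ x → p (false ∷ x)) , (λ x → p (true ∷ x)))
       (allInputs? (λ x → P? (false ∷ x)) ×-dec allInputs? (λ x → P? (true ∷ x)))

agrees? : ∀ {n} (ρ : Knowledge n) → Decidable (Agrees ρ)
agrees? ρ x = all? (λ i → Maybe.dec (lookup x i ≟ᵇ_) (lookup ρ i))

determined? : ∀ {n} (f : BoolFun n) → Decidable (Determined f)
determined? f ρ = allInputs? λ x → allInputs? λ x′ →
  agrees? ρ x →-dec (agrees? ρ x′ →-dec (f x′ ≟ᵇ f x))

-- A decision tree for f, rooted at the state of knowledge ρ; it stops exactly when
-- the value of f is determined and never tests a variable twice.
data DecisionTree {n : ℕ} (f : BoolFun n) (ρ : Knowledge n) : Set where
  stop : Determined f ρ → DecisionTree f ρ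
  test : ¬ Determined f ρ → (i : Fin n) → lookup ρ i ≡ nothing →
         ((b : Bool) → DecisionTree f (ρ [ i ]≔ just b)) → DecisionTree f ρ

AdaptiveStrategy : ∀ {n} → BoolFun n → Set
AdaptiveStrategy f = DecisionTree f noTests

-- π ⟨$⟩ʳ k is the k-th variable in the testing order.
NonAdaptiveStrategy : ℕ → Set
NonAdaptiveStrategy n = Permutation′ n

treeCost : ∀ {n} {f : BoolFun n} {ρ : Knowledge n} →
           Vec ℚ n → DecisionTree f ρ → Input n → ℚ
treeCost c (stop _)       x = 0ℚ
treeCost c (test _ i _ t) x = lookup c i + treeCost c (t (lookup x i)) x

orderCost : ∀ {n} → BoolFun n → Vec ℚ n → Knowledge n → List (Fin n) → Input n → ℚ
orderCost f c ρ []       x = 0ℚ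
orderCost f c ρ (i ∷ is) x =
  if does (determined? f ρ) then 0ℚ
  else lookup c i + orderCost f c (ρ [ i ]≔ just (lookup x i)) is x

inputs : ∀ n → List (Input n)
inputs zero    = [] ∷ []
inputs (suc n) = List.map (false ∷_) (inputs n) ++ List.map (true ∷_) (inputs n)

Pr : ∀ {n} → Vec ℚ n → Input n → ℚ
Pr []       []      = 1ℚ
Pr (p ∷ ps) (b ∷ x) = (if b then p else 1ℚ - p) * Pr ps x

𝔼 : ∀ {n} → Vec ℚ n → (Input n → ℚ) → ℚ
𝔼 {n} p g = List.foldr _+_ 0ℚ (List.map (λ x → Pr p x * g x) (inputs n))

costᴬ : ∀ {n} (f : BoolFun n) (c p : Vec ℚ n) → AdaptiveStrategy f → ℚ
costᴬ f c p S = 𝔼 p (treeCost c S)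

costᴺ : ∀ {n} (f : BoolFun n) (c p : Vec ℚ n) → NonAdaptiveStrategy n → ℚ
costᴺ f c p π = 𝔼 p (orderCost f c noTests (List.tabulate (π ⟨$⟩ʳ_)))

IsMinimum : {S : Set} → (S → ℚ) → ℚ → Set
IsMinimum cost v = (∃[ s ] cost s ≡ v) × (∀ s → v ≤ cost s)

IsOPTᴬ : ∀ {n} (f : BoolFun n) (c p : Vec ℚ n) → ℚ → Set
IsOPTᴬ f c p = IsMinimum (costᴬ f c p)

IsOPTᴺ : ∀ {n} (f : BoolFun n) (c p : Vec ℚ n) → ℚ → Set
IsOPTᴺ f c p = IsMinimum (costᴺ f c p)

ProbabilityVector : ∀ {n} → Vec ℚ n → Set
ProbabilityVector p = ∀ i → 0ℚ < lookup p i × lookup p i < 1ℚ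

unitCosts : ∀ n → Vec ℚ n
unitCosts n = replicate n 1ℚ

{-# OPTIONS --safe #-}

-- Take m = √n terms of m variables each. The first variable of a term, its pivot, is true with
-- probability q = 1/(4m), every other variable with probability 1 − 1/(4m²).
--
-- Adaptively, go through the terms, test the pivot, and test the other variables of the term only
-- if the pivot is true: the expected cost is at most m (1 + q m) = 5m/4.
--
-- Non-adaptively, let `spike j` be the input in which pivot j is true, all other pivots are false
-- and all non-pivots are true. By Bernoulli's inequality it has probability at least q/2. Every
-- variable of term j is critical for it, so an order that tests such a variable at position l
-- performs at least l tests on it. Summing over all positions l, each of the m spikes is counted
-- m times, so the costs of the spikes add up to at least n²/(2m) and the expected cost is at least
-- (q/2) n²/(2m) = m²/16.
module Submission where

open import Defs
open import Data.Bool using (Bool; true; false; if_then_else_; _∧_; _∨_)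
open import Data.Bool.ListAction using (all; any)
open import Data.Bool.Properties using (∧-zeroʳ; ∨-zeroʳ) renaming (_≟_ to _≟ᵇ_)
open import Data.Fin as Fin using (Fin; zero; suc; toℕ; combine; remQuot; punchIn; _↑ˡ_; _↑ʳ_)
open import Data.Fin.Permutation as Perm using (Permutation′; _⟨$⟩ʳ_; _⟨$⟩ˡ_; inverseˡ; _≈_; insert; remove; insert-punchIn; insert-remove)
import Data.Fin.Properties as Fin
import Data.Integer as ℤ
import Data.Integer.Properties as ℤ
open import Data.List as List using (List; []; _∷_; _++_; length; cartesianProductWith; concatMap)
open import Data.List.Membership.Propositional using (_∈_; lose)
open import Data.List.Membership.Propositional.Properties using (∈-concatMap⁺; ∈-cartesianProductWith⁺; ∈-allFin; ∈-tabulate⁻)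
open import Data.List.NonEmpty using (_∷_)
open import Data.List.Properties using (tabulate-cong; map-tabulate; length-tabulate; map-cong)
open import Data.List.Relation.Binary.Disjoint.Propositional using (Disjoint)
open import Data.List.Relation.Unary.All as All using (All; []; _∷_)
import Data.List.Relation.Unary.All.Properties as All
import Data.List.Relation.Unary.AllPairs.Properties as AllPairs
open import Data.List.Relation.Unary.Any using (here; there)
open import Data.Maybe using (Maybe; just; nothing)
import Data.Maybe.Relation.Unary.All as Maybe
open import Data.Nat as ℕ using (ℕ; zero; suc; z≤n; s≤s) renaming (_*_ to _*ℕ_; _≥_ to _≥ℕ_)
open import Data.Nat.Divisibility using (_∣_)
import Data.Nat.Properties as ℕ
open import Data.Product using (_×_; _,_; Σ-syntax; ∃-syntax; proj₁; proj₂)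
open import Data.Rational as ℚ using (ℚ; 0ℚ; 1ℚ; ½; _+_; _*_; _-_; _≤_; _<_; _≥_)
import Data.Rational.Properties as ℚ
open import Data.Rational.Solver using (module +-*-Solver)
import Data.Rational.Unnormalised as ℚᵘ
import Data.Rational.Unnormalised.Properties as ℚᵘ
open import Data.Sum using (_⊎_; inj₁; inj₂)
open import Data.Vec as Vec using (Vec; []; _∷_; lookup; _[_]≔_)
open import Data.Vec.Properties using (≡-dec; lookup∘update; lookup∘update′; lookup-replicate; lookup∘tabulate)
open import Function using (_∘_)
open import Relation.Binary.Bundles using (DecTotalOrder)
open import Relation.Binary.PropositionalEquality
open import Relation.Nullary using (¬_; yes; no; contradiction; does; Dec)
open import Relation.Nullary.Decidable using (dec-true; dec-false)

open import Algebra.Properties.CommutativeMonoid.Sum ℚ.+-0-commutativeMonoid using (sum; sum-permute; sum-cong-≗; ∑-distrib-+)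
open import Data.List.Extrema (DecTotalOrder.totalOrder ℚ.≤-decTotalOrder) using (argmin; f[argmin]≤f[xs])
open +-*-Solver using (solve; con; _:+_; _:*_; _:-_; _:=_)

-- Existence of the minima

module _ {S : Set} (cost : S → ℚ) where

  -- Strategies contain functions and proofs, so a finite list cannot be expected to contain each of
  -- them up to `≡`. For a minimum it suffices that the list realises every cost.
  minimum-exists : S → (L : List S) → (∀ s → ∃[ s′ ] s′ ∈ L × cost s′ ≡ cost s) →
                   ∃[ v ] IsMinimum cost v
  minimum-exists s₀ L complete =
    cost best , (best , refl) , λ s →
      let (s′ , s′∈L , eq) = complete s
      in subst (cost best ≤_) eq (All.lookup (f[argmin]≤f[xs] {f = cost} s₀ L) s′∈L)
    where best = argmin cost s₀ L

permutations : ∀ n → List (Permutation′ n)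
permutations zero    = Perm.id ∷ []
permutations (suc n) = cartesianProductWith (insert zero) (List.allFin (suc n)) (permutations n)

insert-zero-cong : ∀ {n} j {π σ : Permutation′ n} → π ≈ σ → insert zero j π ≈ insert zero j σ
insert-zero-cong j π≈σ zero = refl
insert-zero-cong j {π} {σ} π≈σ (suc k) =
  trans (insert-punchIn zero j π k)
    (trans (cong (punchIn j) (π≈σ k)) (sym (insert-punchIn zero j σ k)))

-- A permutation is recovered from the image of `zero` and the permutation that remains once `zero`
-- is removed. Only `≈` is claimed, since equality of permutations would need function
-- extensionality; the testing order depends on the values alone.
permutations-complete : ∀ {n} (π : Permutation′ n) → ∃[ σ ] σ ∈ permutations n × σ ≈ π
permutations-complete {zero}  π = Perm.id , here refl , λ ()
permutations-complete {suc n} π with permutations-complete (remove zero π)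
... | σ , σ∈ , σ≈ =
  insert zero (π ⟨$⟩ʳ zero) σ ,
  ∈-cartesianProductWith⁺ (insert zero) (∈-allFin (π ⟨$⟩ʳ zero)) σ∈ ,
  λ i → trans (insert-zero-cong (π ⟨$⟩ʳ zero) {σ} {remove zero π} σ≈ i) (insert-remove zero π i)

optᴺ-exists : ∀ {n} (f : BoolFun n) (c p : Vec ℚ n) → ∃[ v ] IsOPTᴺ f c p v
optᴺ-exists {n} f c p = minimum-exists (costᴺ f c p) Perm.id (permutations n) λ π →
  let (σ , σ∈ , σ≈) = permutations-complete π
  in σ , σ∈ , cong (λ is → 𝔼 p (orderCost f c noTests is)) (tabulate-cong σ≈)

unknowns : ∀ {n} → Knowledge n → ℕ
unknowns []            = 0
unknowns (nothing ∷ ρ) = suc (unknowns ρ)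
unknowns (just _ ∷ ρ)  = unknowns ρ

-- Each test uses up one unknown, so `unknowns ρ` bounds the depth of every tree rooted at `ρ` and
-- can serve as fuel for the enumeration.
unknowns-update : ∀ {n} (ρ : Knowledge n) i b → lookup ρ i ≡ nothing →
                  suc (unknowns (ρ [ i ]≔ just b)) ≡ unknowns ρ
unknowns-update (nothing ∷ ρ) zero    b eq = refl
unknowns-update (nothing ∷ ρ) (suc i) b eq = cong suc (unknowns-update ρ i b eq)
unknowns-update (just _ ∷ ρ)  (suc i) b eq = unknowns-update ρ i b eq

𝔼-cong : ∀ {n} (p : Vec ℚ n) {g h : Input n → ℚ} → (∀ x → g x ≡ h x) → 𝔼 p g ≡ 𝔼 p h
𝔼-cong {n} p g≗h = cong (List.foldr _+_ 0ℚ)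
  (map-cong (λ x → cong (Pr p x *_) (g≗h x)) (inputs n))

module _ {n : ℕ} {f : BoolFun n} where

  branch : ∀ {ρ : Knowledge n} {i} → ¬ Determined f ρ → lookup ρ i ≡ nothing →
           DecisionTree f (ρ [ i ]≔ just false) → DecisionTree f (ρ [ i ]≔ just true) →
           DecisionTree f ρ
  branch ¬d eq t₀ t₁ = test ¬d _ eq λ { false → t₀ ; true → t₁ }

  treesUpTo : ℕ → (ρ : Knowledge n) → List (DecisionTree f ρ)
  -- The value `v` is passed together with its equation, so that one can match on it while the type
  -- of the resulting trees still mentions `lookup ρ i`.
  treesTesting : ℕ → (ρ : Knowledge n) → ¬ Determined f ρ → (i : Fin n) (v : Maybe Bool) →
                 lookup ρ i ≡ v → List (DecisionTree f ρ)

  treesUpTo d ρ with determined? f ρ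
  treesUpTo d       ρ | yes det = stop det ∷ []
  treesUpTo zero    ρ | no ¬det = []
  treesUpTo (suc d) ρ | no ¬det =
    concatMap (λ i → treesTesting d ρ ¬det i (lookup ρ i) refl) (List.allFin n)

  treesTesting d ρ ¬det i (just _) eq = []
  treesTesting d ρ ¬det i nothing  eq =
    cartesianProductWith (branch ¬det eq)
      (treesUpTo d (ρ [ i ]≔ just false)) (treesUpTo d (ρ [ i ]≔ just true))

  module _ (c : Vec ℚ n) where

    _≃_ : ∀ {ρ} → DecisionTree f ρ → DecisionTree f ρ → Set
    t ≃ u = ∀ x → treeCost c t x ≡ treeCost c u x

    -- Induction on the fuel. The enumerated tree takes its proofs from `determined?` and its
    -- branching function from `branch`, so it agrees with `t` only in cost, which is what `≃`
    -- records.
    treesUpTo-complete : ∀ d ρ (t : DecisionTree f ρ) → unknowns ρ ℕ.≤ d →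
                         ∃[ u ] u ∈ treesUpTo d ρ × u ≃ t
    treesTesting-complete : ∀ d ρ ¬det i v eq ¬det′ (untested : lookup ρ i ≡ nothing) t →
                            unknowns ρ ℕ.≤ suc d →
                            ∃[ u ] u ∈ treesTesting d ρ ¬det i v eq × u ≃ test ¬det′ i untested t

    treesUpTo-complete d ρ t le with determined? f ρ
    treesUpTo-complete d ρ (stop _)        le | yes det = stop det , here refl , λ _ → refl
    treesUpTo-complete d ρ (test ¬d _ _ _) le | yes det = contradiction det ¬d
    treesUpTo-complete d ρ (stop det)      le | no ¬det = contradiction det ¬det
    treesUpTo-complete zero ρ (test _ i eq t) le | no ¬det =
      contradiction (subst (ℕ._≤ 0) (sym (unknowns-update ρ i true eq)) le) λ ()
    treesUpTo-complete (suc d) ρ (test ¬d i eq t) le | no ¬det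
      with treesTesting-complete d ρ ¬det i (lookup ρ i) refl ¬d eq t le
    ... | u , u∈ , u≃ = u , ∈-concatMap⁺ _ (lose (∈-allFin i) u∈) , u≃

    treesTesting-complete d ρ ¬det i (just _) eq ¬det′ eq′ t le =
      contradiction (trans (sym eq) eq′) λ ()
    treesTesting-complete d ρ ¬det i nothing eq ¬det′ eq′ t le =
      branch ¬det eq (proj₁ (sub false)) (proj₁ (sub true)) ,
      ∈-cartesianProductWith⁺ (branch ¬det eq)
        (proj₁ (proj₂ (sub false))) (proj₁ (proj₂ (sub true))) ,
      same
      where
      sub : ∀ b → ∃[ u ] u ∈ treesUpTo d (ρ [ i ]≔ just b) × u ≃ t b
      sub b = treesUpTo-complete d (ρ [ i ]≔ just b) (t b)
        (ℕ.s≤s⁻¹ (subst (ℕ._≤ suc d) (sym (unknowns-update ρ i b eq′)) le))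
      same : branch ¬det eq (proj₁ (sub false)) (proj₁ (sub true)) ≃ test ¬det′ i eq′ t
      same x with lookup x i
      ... | false = cong (lookup c i +_) (proj₂ (proj₂ (sub false)) x)
      ... | true  = cong (lookup c i +_) (proj₂ (proj₂ (sub true)) x)

  optᴬ-exists : (c p : Vec ℚ n) → AdaptiveStrategy f → ∃[ v ] IsOPTᴬ f c p v
  optᴬ-exists c p S = minimum-exists (costᴬ f c p) S (treesUpTo depth noTests) λ t →
    let (u , u∈ , u≃) = treesUpTo-complete c depth noTests t ℕ.≤-refl
    in u , u∈ , 𝔼-cong p u≃
    where depth = unknowns (noTests {n})

-- Counting tests under unit costs

ℕ→ℚ-+ : ∀ a b → ℕ→ℚ (a ℕ.+ b) ≡ ℕ→ℚ a + ℕ→ℚ b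
ℕ→ℚ-+ a b = ℚ.toℚᵘ-injective (begin
  ℚ.toℚᵘ (ℕ→ℚ (a ℕ.+ b))                ≈⟨ ℚ.toℚᵘ-fromℚᵘ _ ⟩
  ℚᵘ.mkℚᵘ (ℤ.+ (a ℕ.+ b)) 0
    ≈⟨ ℚᵘ.*≡* (cong (ℤ._* ℤ.1ℤ)
         (cong₂ ℤ._+_ (sym (ℤ.*-identityʳ (ℤ.+ a))) (sym (ℤ.*-identityʳ (ℤ.+ b))))) ⟩
  ℚᵘ.mkℚᵘ (ℤ.+ a) 0 ℚᵘ.+ ℚᵘ.mkℚᵘ (ℤ.+ b) 0
    ≈⟨ ℚᵘ.+-cong (ℚ.toℚᵘ-fromℚᵘ (ℚᵘ.mkℚᵘ (ℤ.+ a) 0)) (ℚ.toℚᵘ-fromℚᵘ (ℚᵘ.mkℚᵘ (ℤ.+ b) 0)) ⟨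
  ℚ.toℚᵘ (ℕ→ℚ a) ℚᵘ.+ ℚ.toℚᵘ (ℕ→ℚ b)    ≈⟨ ℚ.toℚᵘ-homo-+ (ℕ→ℚ a) (ℕ→ℚ b) ⟨
  ℚ.toℚᵘ (ℕ→ℚ a + ℕ→ℚ b)                ∎)
  where open ℚᵘ.≃-Reasoning

ℕ→ℚ-mono-≤ : ∀ {a b} → a ℕ.≤ b → ℕ→ℚ a ≤ ℕ→ℚ b
ℕ→ℚ-mono-≤ {a} {b} a≤b with ℕ.m≤n⇒∃[o]m+o≡n a≤b
... | d , refl = subst₂ _≤_ (ℚ.+-identityʳ _) (sym (ℕ→ℚ-+ a d))
  (ℚ.+-monoʳ-≤ (ℕ→ℚ a) (ℚ.nonNegative⁻¹ (ℕ→ℚ d) {{ℚ.normalize-nonNeg d 1}}))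

0≤ℕ→ℚ : ∀ a → 0ℚ ≤ ℕ→ℚ a
0≤ℕ→ℚ a = ℕ→ℚ-mono-≤ {0} {a} z≤n

ℕ→ℚ-* : ∀ a b → ℕ→ℚ (a ℕ.* b) ≡ ℕ→ℚ a * ℕ→ℚ b
ℕ→ℚ-* zero    b = sym (ℚ.*-zeroˡ (ℕ→ℚ b))
ℕ→ℚ-* (suc a) b = begin
  ℕ→ℚ (b ℕ.+ a ℕ.* b)         ≡⟨ ℕ→ℚ-+ b (a ℕ.* b) ⟩
  ℕ→ℚ b + ℕ→ℚ (a ℕ.* b)       ≡⟨ cong₂ _+_ (sym (ℚ.*-identityˡ (ℕ→ℚ b))) (ℕ→ℚ-* a b) ⟩
  1ℚ * ℕ→ℚ b + ℕ→ℚ a * ℕ→ℚ b  ≡⟨ ℚ.*-distribʳ-+ (ℕ→ℚ b) 1ℚ (ℕ→ℚ a) ⟨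
  (1ℚ + ℕ→ℚ a) * ℕ→ℚ b        ≡⟨ cong (_* ℕ→ℚ b) (ℕ→ℚ-+ 1 a) ⟨
  ℕ→ℚ (suc a) * ℕ→ℚ b         ∎
  where open ≡-Reasoning

module _ {n : ℕ} {f : BoolFun n} where

  treeLength : ∀ {ρ} → DecisionTree f ρ → Input n → ℕ
  treeLength (stop _)       x = 0
  treeLength (test _ i _ t) x = suc (treeLength (t (lookup x i)) x)

  treeCost-unit : ∀ {ρ} (t : DecisionTree f ρ) x → treeCost (unitCosts n) t x ≡ ℕ→ℚ (treeLength t x)
  treeCost-unit (stop _)       x = refl
  treeCost-unit (test _ i _ t) x = trans
    (cong₂ _+_ (lookup-replicate i 1ℚ) (treeCost-unit (t (lookup x i)) x))
    (sym (ℕ→ℚ-+ 1 (treeLength (t (lookup x i)) x)))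

orderLength : ∀ {n} → BoolFun n → Knowledge n → List (Fin n) → Input n → ℕ
orderLength f ρ []       x = 0
orderLength f ρ (i ∷ is) x =
  if does (determined? f ρ) then 0 else suc (orderLength f (ρ [ i ]≔ just (lookup x i)) is x)

orderCost-unit : ∀ {n} (f : BoolFun n) ρ is x →
                 orderCost f (unitCosts n) ρ is x ≡ ℕ→ℚ (orderLength f ρ is x)
orderCost-unit f ρ []       x = refl
orderCost-unit f ρ (i ∷ is) x with does (determined? f ρ)
... | true  = refl
... | false = trans
  (cong₂ _+_ (lookup-replicate i 1ℚ) (orderCost-unit f (ρ [ i ]≔ just (lookup x i)) is x))
  (sym (ℕ→ℚ-+ 1 (orderLength f (ρ [ i ]≔ just (lookup x i)) is x)))

-- States of knowledge

module _ {n : ℕ} where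

  agrees-lookup : ∀ (ρ : Knowledge n) x {i b} → Agrees ρ x → lookup ρ i ≡ just b → lookup x i ≡ b
  agrees-lookup ρ x {i} a eq = Maybe.drop-just (subst (Maybe.All (lookup x i ≡_)) eq (a i))

  agrees-noTests : (x : Input n) → Agrees noTests x
  agrees-noTests x i rewrite lookup-replicate i (nothing {A = Bool}) = Maybe.nothing

  agrees-learn : ∀ (ρ : Knowledge n) x i → Agrees ρ x → Agrees (ρ [ i ]≔ just (lookup x i)) x
  agrees-learn ρ x i a j with j Fin.≟ i
  ... | yes refl rewrite lookup∘update i ρ (just (lookup x i)) = Maybe.just refl
  ... | no  j≢i  rewrite lookup∘update′ j≢i ρ (just (lookup x i)) = a j

  agrees-flip : ∀ (ρ : Knowledge n) x v b → Agrees ρ x → lookup ρ v ≡ nothing →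
                Agrees ρ (x [ v ]≔ b)
  agrees-flip ρ x v b a untested j with j Fin.≟ v
  ... | yes refl rewrite untested = Maybe.nothing
  ... | no  j≢v  rewrite lookup∘update′ j≢v x b = a j

  infix 4 _⊑_
  _⊑_ : Knowledge n → Knowledge n → Set
  ρ ⊑ ρ′ = ∀ i {b} → lookup ρ i ≡ just b → lookup ρ′ i ≡ just b

  ⊑-learn : ∀ (ρ : Knowledge n) i b → lookup ρ i ≡ nothing → ρ ⊑ ρ [ i ]≔ just b
  ⊑-learn ρ i b untested j eq with j Fin.≟ i
  ... | yes refl = contradiction (trans (sym untested) eq) λ ()
  ... | no  j≢i  = trans (lookup∘update′ j≢i ρ (just b)) eq

  Known : Knowledge n → Fin n → Set
  Known ρ i = ∃[ b ] lookup ρ i ≡ just b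

-- Decision trees with a bound on the number of tests

module _ {n : ℕ} (f : BoolFun n) where

  -- The bound depends on the input so that its expectation can be taken later. Inputs contradicting
  -- `ρ` never reach this state, and nothing is asked of them.
  TreeWithin : Knowledge n → (Input n → ℕ) → Set
  TreeWithin ρ B = Σ[ t ∈ DecisionTree f ρ ] (∀ x → Agrees ρ x → treeLength t x ℕ.≤ B x)

  -- Known variables are skipped, so `is` may repeat or overlap earlier tests.
  testAll : ∀ is {ρ B} → (∀ {ρ′} → ρ ⊑ ρ′ → All (Known ρ′) is → TreeWithin ρ′ B) →
            TreeWithin ρ (λ x → length is ℕ.+ B x)
  testAll []       next = next (λ _ eq → eq) []
  testAll (i ∷ is) {ρ} {B} next with determined? f ρ
  ... | yes det = stop det , λ _ _ → z≤n
  ... | no ¬det with lookup ρ i in eq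
  ...   | just b = proj₁ sub , λ x a → ℕ.m≤n⇒m≤1+n (proj₂ sub x a)
    where
    sub : TreeWithin ρ (λ x → length is ℕ.+ B x)
    sub = testAll is λ ext known → next ext ((b , ext i eq) ∷ known)
  ...   | nothing = test ¬det i eq (λ b → proj₁ (sub b)) ,
                    λ x a → s≤s (proj₂ (sub (lookup x i)) x (agrees-learn ρ x i a))
    where
    sub : ∀ b → TreeWithin (ρ [ i ]≔ just b) (λ x → length is ℕ.+ B x)
    sub b = testAll is λ ext known →
      next (λ j e → ext j (⊑-learn ρ i b eq j e)) ((b , ext i (lookup∘update i ρ (just b))) ∷ known)

-- Critical variables force tests

module _ {n : ℕ} {f : BoolFun n} {x : Input n} where

  undetermined : ∀ ρ v b → Agrees ρ x → lookup ρ v ≡ nothing →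
                 f (x [ v ]≔ b) ≢ f x → ¬ Determined f ρ
  undetermined ρ v b a untested critical det =
    critical (det x (x [ v ]≔ b) a (agrees-flip ρ x v b a untested))

  -- As long as the critical variable `g i` is untested, flipping it gives an input that agrees with
  -- all outcomes but has another value, so testing goes on. Injectivity of `g` ensures that no
  -- earlier test reveals `g i`. Positions start at 0, hence the strict inequality.
  orderLength-critical : ∀ {k} (g : Fin k → Fin n) → (∀ {i j} → g i ≡ g j → i ≡ j) → ∀ i ρ b →
                         Agrees ρ x → lookup ρ (g i) ≡ nothing → f (x [ g i ]≔ b) ≢ f x →
                         toℕ i ℕ.< orderLength f ρ (List.tabulate g) x
  orderLength-critical g inj zero ρ b a untested critical with determined? f ρ
  ... | yes det = contradiction det (undetermined ρ (g zero) b a untested critical)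
  ... | no  _   = s≤s z≤n
  orderLength-critical g inj (suc i) ρ b a untested critical with determined? f ρ
  ... | yes det = contradiction det (undetermined ρ (g (suc i)) b a untested critical)
  ... | no  _   = s≤s (orderLength-critical (g ∘ suc) (Fin.suc-injective ∘ inj) i _ b
    (agrees-learn ρ x (g zero) a)
    (trans (lookup∘update′ (λ e → contradiction (inj e) λ ()) ρ _) untested)
    critical)

-- Rational sums

*-monoˡ : ∀ {a b c} → 0ℚ ≤ a → b ≤ c → a * b ≤ a * c
*-monoˡ {a} 0≤a = ℚ.*-monoˡ-≤-nonNeg a {{ℚ.nonNegative 0≤a}}

0≤* : ∀ {a b} → 0ℚ ≤ a → 0ℚ ≤ b → 0ℚ ≤ a * b
0≤* {a} {b} 0≤a 0≤b = subst (_≤ a * b) (ℚ.*-zeroʳ a) (*-monoˡ 0≤a 0≤b)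

0≤+ : ∀ {a b} → 0ℚ ≤ a → 0ℚ ≤ b → 0ℚ ≤ a + b
0≤+ = ℚ.+-mono-≤

-- Turns an inequality into an identity for the ring solver, once the nonnegative difference `c` is
-- named.
≤-+ʳ : ∀ {a b c} → 0ℚ ≤ c → a + c ≡ b → a ≤ b
≤-+ʳ {a} 0≤c eq = subst₂ _≤_ (ℚ.+-identityʳ a) eq (ℚ.+-monoʳ-≤ a 0≤c)

0≤1- : ∀ {a} → a ≤ 1ℚ → 0ℚ ≤ 1ℚ - a
0≤1- {a} a≤1 = subst (_≤ 1ℚ - a) (ℚ.+-inverseʳ a) (ℚ.+-monoˡ-≤ (ℚ.- a) a≤1)

sum-mono : ∀ {n} {f g : Fin n → ℚ} → (∀ i → f i ≤ g i) → sum f ≤ sum g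
sum-mono {zero}  f≤g = ℚ.≤-refl
sum-mono {suc n} f≤g = ℚ.+-mono-≤ (f≤g zero) (sum-mono (f≤g ∘ suc))

sum-const : ∀ n a → sum {n} (λ _ → a) ≡ ℕ→ℚ n * a
sum-const zero    a = sym (ℚ.*-zeroˡ a)
sum-const (suc n) a = begin
  a + sum {n} (λ _ → a)  ≡⟨ cong (a +_) (sum-const n a) ⟩
  a + ℕ→ℚ n * a          ≡⟨ solve 2 (λ a N → a :+ N :* a := (con 1ℚ :+ N) :* a) refl a (ℕ→ℚ n) ⟩
  (1ℚ + ℕ→ℚ n) * a       ≡⟨ cong (_* a) (ℕ→ℚ-+ 1 n) ⟨
  ℕ→ℚ (suc n) * a        ∎
  where open ≡-Reasoning

0≤sum : ∀ {n} {f : Fin n → ℚ} → (∀ i → 0ℚ ≤ f i) → 0ℚ ≤ sum f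
0≤sum {n} {f} 0≤f = subst (_≤ sum f) (trans (sum-const n 0ℚ) (ℚ.*-zeroʳ (ℕ→ℚ n))) (sum-mono 0≤f)

*-distribˡ-sum : ∀ {n} a (f : Fin n → ℚ) → a * sum f ≡ sum (λ i → a * f i)
*-distribˡ-sum {zero}  a f = ℚ.*-zeroʳ a
*-distribˡ-sum {suc n} a f =
  trans (ℚ.*-distribˡ-+ a (f zero) _) (cong (a * f zero +_) (*-distribˡ-sum a (f ∘ suc)))

sum-↑ : ∀ k {l} (f : Fin (k ℕ.+ l) → ℚ) → sum f ≡ sum (λ i → f (i ↑ˡ l)) + sum (λ i → f (k ↑ʳ i))
sum-↑ zero    f = sym (ℚ.+-identityˡ (sum f))
sum-↑ (suc k) f = trans (cong (f zero +_) (sum-↑ k (f ∘ suc))) (sym (ℚ.+-assoc (f zero) _ _))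

sum-combine : ∀ a {b} (f : Fin (a ℕ.* b) → ℚ) →
              sum f ≡ sum {a} (λ j → sum {b} (λ i → f (combine j i)))
sum-combine zero        f = refl
sum-combine (suc a) {b} f = trans (sum-↑ b f)
  (cong (sum (λ i → f (i ↑ˡ a ℕ.* b)) +_) (sum-combine a (f ∘ (b ↑ʳ_))))

-- Gauss's sum, doubled to avoid a division. The summand `suc (toℕ i)` is the number of tests made
-- once position `i` has been reached.
triangular : ∀ n → let T = sum {n} (λ i → ℕ→ℚ (suc (toℕ i))) in T + T ≡ ℕ→ℚ n * ℕ→ℚ n + ℕ→ℚ n
triangular zero    = refl
triangular (suc n) = begin
  (1ℚ + T′) + (1ℚ + T′)                  ≡⟨ cong (λ z → (1ℚ + z) + (1ℚ + z)) shift ⟩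
  (1ℚ + (N + T)) + (1ℚ + (N + T))
    ≡⟨ solve 2 (λ N T → (con 1ℚ :+ (N :+ T)) :+ (con 1ℚ :+ (N :+ T))
         := con 1ℚ :+ con 1ℚ :+ N :+ N :+ (T :+ T)) refl N T ⟩
  1ℚ + 1ℚ + N + N + (T + T)              ≡⟨ cong (1ℚ + 1ℚ + N + N +_) (triangular n) ⟩
  1ℚ + 1ℚ + N + N + (N * N + N)
    ≡⟨ solve 1 (λ N → con 1ℚ :+ con 1ℚ :+ N :+ N :+ (N :* N :+ N)
         := (con 1ℚ :+ N) :* (con 1ℚ :+ N) :+ (con 1ℚ :+ N)) refl N ⟩
  (1ℚ + N) * (1ℚ + N) + (1ℚ + N)         ≡⟨ cong (λ z → z * z + z) (ℕ→ℚ-+ 1 n) ⟨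
  ℕ→ℚ (suc n) * ℕ→ℚ (suc n) + ℕ→ℚ (suc n) ∎
  where
  open ≡-Reasoning
  N = ℕ→ℚ n
  T = sum {n} (λ i → ℕ→ℚ (suc (toℕ i)))
  T′ = sum {n} (λ i → ℕ→ℚ (suc (suc (toℕ i))))
  shift : T′ ≡ N + T
  shift = begin
    T′
      ≡⟨ sum-cong-≗ {n} (λ i → ℕ→ℚ-+ 1 (suc (toℕ i))) ⟩
    sum {n} (λ i → 1ℚ + ℕ→ℚ (suc (toℕ i)))
      ≡⟨ ∑-distrib-+ {n} (λ _ → 1ℚ) (λ i → ℕ→ℚ (suc (toℕ i))) ⟩
    sum {n} (λ _ → 1ℚ) + T
      ≡⟨ cong (_+ T) (trans (sum-const n 1ℚ) (ℚ.*-identityʳ N)) ⟩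
    N + T                                            ∎

-- Expectations

total : ∀ {A : Set} → (A → ℚ) → List A → ℚ
total h xs = List.foldr _+_ 0ℚ (List.map h xs)

total-++ : ∀ {A : Set} (h : A → ℚ) xs ys → total h (xs ++ ys) ≡ total h xs + total h ys
total-++ h []       ys = sym (ℚ.+-identityˡ _)
total-++ h (x ∷ xs) ys = trans (cong (h x +_) (total-++ h xs ys)) (sym (ℚ.+-assoc (h x) _ _))

total-map-* : ∀ {A B : Set} w (k : A → B) {h : B → ℚ} {h′ : A → ℚ} → (∀ x → h (k x) ≡ w * h′ x) →
              ∀ xs → total h (List.map k xs) ≡ w * total h′ xs
total-map-* w k eq []       = sym (ℚ.*-zeroʳ w)
total-map-* w k {h′ = h′} eq (x ∷ xs) =
  trans (cong₂ _+_ (eq x) (total-map-* w k eq xs)) (sym (ℚ.*-distribˡ-+ w (h′ x) _))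

-- Conditioning on the first coordinate; the inductions on `p` below rest on it.
𝔼-∷ : ∀ {n} q (p : Vec ℚ n) g →
      𝔼 (q ∷ p) g ≡ (1ℚ - q) * 𝔼 p (λ x → g (false ∷ x)) + q * 𝔼 p (λ x → g (true ∷ x))
𝔼-∷ {n} q p g = trans
  (total-++ (λ x → Pr (q ∷ p) x * g x) (List.map (false ∷_) (inputs n)) (List.map (true ∷_) (inputs n)))
  (cong₂ _+_
    (total-map-* (1ℚ - q) (false ∷_) (λ x → ℚ.*-assoc (1ℚ - q) (Pr p x) (g (false ∷ x))) (inputs n))
    (total-map-* q (true ∷_) (λ x → ℚ.*-assoc q (Pr p x) (g (true ∷ x))) (inputs n)))

𝔼-const : ∀ {n} (p : Vec ℚ n) a → 𝔼 p (λ _ → a) ≡ a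
𝔼-const []      a = trans (ℚ.+-identityʳ (1ℚ * a)) (ℚ.*-identityˡ a)
𝔼-const (q ∷ p) a = begin
  𝔼 (q ∷ p) (λ _ → a)                              ≡⟨ 𝔼-∷ q p (λ _ → a) ⟩
  (1ℚ - q) * 𝔼 p (λ _ → a) + q * 𝔼 p (λ _ → a)
    ≡⟨ cong (λ z → (1ℚ - q) * z + q * z) (𝔼-const p a) ⟩
  (1ℚ - q) * a + q * a
    ≡⟨ solve 2 (λ q a → (con 1ℚ :- q) :* a :+ q :* a := a) refl q a ⟩
  a                                                ∎
  where open ≡-Reasoning

𝔼-+ : ∀ {n} (p : Vec ℚ n) g h → 𝔼 p (λ x → g x + h x) ≡ 𝔼 p g + 𝔼 p h
𝔼-+ []      g h = solve 2 (λ a b → con 1ℚ :* (a :+ b) :+ con 0ℚ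
     := (con 1ℚ :* a :+ con 0ℚ) :+ (con 1ℚ :* b :+ con 0ℚ)) refl (g []) (h [])
𝔼-+ (q ∷ p) g h = begin
  𝔼 (q ∷ p) (λ x → g x + h x)
    ≡⟨ 𝔼-∷ q p (λ x → g x + h x) ⟩
  (1ℚ - q) * 𝔼 p (λ x → g (false ∷ x) + h (false ∷ x)) + q * 𝔼 p (λ x → g (true ∷ x) + h (true ∷ x))
    ≡⟨ cong₂ (λ a b → (1ℚ - q) * a + q * b) (𝔼-+ p (g ∘ (false ∷_)) (h ∘ (false ∷_)))
         (𝔼-+ p (g ∘ (true ∷_)) (h ∘ (true ∷_))) ⟩
  (1ℚ - q) * (g₀ + h₀) + q * (g₁ + h₁)
    ≡⟨ solve 6 (λ r q a b c d → r :* (a :+ b) :+ q :* (c :+ d)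
         := (r :* a :+ q :* c) :+ (r :* b :+ q :* d)) refl (1ℚ - q) q g₀ h₀ g₁ h₁ ⟩
  ((1ℚ - q) * g₀ + q * g₁) + ((1ℚ - q) * h₀ + q * h₁)
    ≡⟨ cong₂ _+_ (𝔼-∷ q p g) (𝔼-∷ q p h) ⟨
  𝔼 (q ∷ p) g + 𝔼 (q ∷ p) h ∎
  where
  open ≡-Reasoning
  g₀ = 𝔼 p (g ∘ (false ∷_))
  g₁ = 𝔼 p (g ∘ (true ∷_))
  h₀ = 𝔼 p (h ∘ (false ∷_))
  h₁ = 𝔼 p (h ∘ (true ∷_))

𝔼-sum : ∀ {n} (p : Vec ℚ n) {k} (h : Fin k → Input n → ℚ) →
        𝔼 p (λ x → sum (λ j → h j x)) ≡ sum (λ j → 𝔼 p (h j))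
𝔼-sum p {zero}  h = 𝔼-const p 0ℚ
𝔼-sum p {suc k} h = trans (𝔼-+ p (h zero) (λ x → sum (λ j → h (suc j) x)))
  (cong (𝔼 p (h zero) +_) (𝔼-sum p (h ∘ suc)))

𝔼-mono : ∀ {n} (p : Vec ℚ n) → ProbabilityVector p → ∀ {g h} → (∀ x → g x ≤ h x) → 𝔼 p g ≤ 𝔼 p h
𝔼-mono []      pv {g} {h} g≤h = ℚ.+-monoˡ-≤ 0ℚ (*-monoˡ (ℚ.<⇒≤ (ℚ.positive⁻¹ 1ℚ)) (g≤h []))
𝔼-mono (q ∷ p) pv {g} {h} g≤h = subst₂ _≤_ (sym (𝔼-∷ q p g)) (sym (𝔼-∷ q p h)) (ℚ.+-mono-≤
  (*-monoˡ (0≤1- (ℚ.<⇒≤ (proj₂ (pv zero)))) (𝔼-mono p (pv ∘ suc) (g≤h ∘ (false ∷_))))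
  (*-monoˡ (ℚ.<⇒≤ (proj₁ (pv zero))) (𝔼-mono p (pv ∘ suc) (g≤h ∘ (true ∷_)))))

𝔼-if : ∀ {n} (p : Vec ℚ n) i a → 𝔼 p (λ x → if lookup x i then a else 0ℚ) ≡ lookup p i * a
𝔼-if (q ∷ p) zero    a = begin
  𝔼 (q ∷ p) (λ x → if lookup x zero then a else 0ℚ)
    ≡⟨ 𝔼-∷ q p (λ x → if lookup x zero then a else 0ℚ) ⟩
  (1ℚ - q) * 𝔼 p (λ _ → 0ℚ) + q * 𝔼 p (λ _ → a)
    ≡⟨ cong₂ (λ y z → (1ℚ - q) * y + q * z) (𝔼-const p 0ℚ) (𝔼-const p a) ⟩
  (1ℚ - q) * 0ℚ + q * a
    ≡⟨ solve 2 (λ q a → (con 1ℚ :- q) :* con 0ℚ :+ q :* a := q :* a) refl q a ⟩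
  q * a                                                ∎
  where open ≡-Reasoning
𝔼-if (q ∷ p) (suc i) a = begin
  𝔼 (q ∷ p) (λ x → if lookup x (suc i) then a else 0ℚ)
    ≡⟨ 𝔼-∷ q p (λ x → if lookup x (suc i) then a else 0ℚ) ⟩
  (1ℚ - q) * E + q * E
    ≡⟨ solve 2 (λ q e → (con 1ℚ :- q) :* e :+ q :* e := e) refl q E ⟩
  E                                                     ≡⟨ 𝔼-if p i a ⟩
  lookup p i * a                                        ∎
  where
  open ≡-Reasoning
  E = 𝔼 p (λ x → if lookup x i then a else 0ℚ)

_≟ᵛ_ : ∀ {n} (x y : Input n) → Dec (x ≡ y)
_≟ᵛ_ = ≡-dec _≟ᵇ_

𝔼-point : ∀ {n} (p : Vec ℚ n) y a → 𝔼 p (λ x → if does (x ≟ᵛ y) then a else 0ℚ) ≡ Pr p y * a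
𝔼-point []      []      a = ℚ.+-identityʳ (1ℚ * a)
𝔼-point (q ∷ p) (b ∷ y) a = trans
  (𝔼-∷ q p (λ x → if does (x ≟ᵛ (b ∷ y)) then a else 0ℚ)) (split b)
  where
  open ≡-Reasoning
  E = 𝔼 p (λ x → if does (x ≟ᵛ y) then a else 0ℚ)
  split : ∀ b → (1ℚ - q) * 𝔼 p (λ x → if does ((false ∷ x) ≟ᵛ (b ∷ y)) then a else 0ℚ)
              + q * 𝔼 p (λ x → if does ((true ∷ x) ≟ᵛ (b ∷ y)) then a else 0ℚ)
              ≡ Pr (q ∷ p) (b ∷ y) * a
  split false = begin
    (1ℚ - q) * E + q * 𝔼 p (λ _ → 0ℚ)
      ≡⟨ cong₂ (λ u v → (1ℚ - q) * u + q * v) (𝔼-point p y a) (𝔼-const p 0ℚ) ⟩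
    (1ℚ - q) * (Pr p y * a) + q * 0ℚ
      ≡⟨ solve 3 (λ q r a → (con 1ℚ :- q) :* (r :* a) :+ q :* con 0ℚ
           := (con 1ℚ :- q) :* r :* a) refl q (Pr p y) a ⟩
    (1ℚ - q) * Pr p y * a               ∎
  split true = begin
    (1ℚ - q) * 𝔼 p (λ _ → 0ℚ) + q * E
      ≡⟨ cong₂ (λ u v → (1ℚ - q) * u + q * v) (𝔼-const p 0ℚ) (𝔼-point p y a) ⟩
    (1ℚ - q) * 0ℚ + q * (Pr p y * a)
      ≡⟨ solve 3 (λ q r a → (con 1ℚ :- q) :* con 0ℚ :+ q :* (r :* a)
           := q :* r :* a) refl q (Pr p y) a ⟩
    q * Pr p y * a                      ∎

module _ {n : ℕ} (g : Input n → ℚ) (0≤g : ∀ x → 0ℚ ≤ g x) where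

  -- The points are distinct, so at most one summand is nonzero at `x`, and that one equals `g x`.
  points≤ : ∀ {k} (y : Fin k → Input n) → (∀ {i j} → y i ≡ y j → i ≡ j) → ∀ x →
            sum (λ j → if does (x ≟ᵛ y j) then g (y j) else 0ℚ) ≤ g x
  points≤ {zero}  y inj x = 0≤g x
  points≤ {suc k} y inj x with x ≟ᵛ y zero
  ... | yes refl = ℚ.≤-reflexive (trans (cong (g x +_) rest) (ℚ.+-identityʳ (g x)))
    where
    other : ∀ j → (if does (x ≟ᵛ y (suc j)) then g (y (suc j)) else 0ℚ) ≡ 0ℚ
    other j with x ≟ᵛ y (suc j)
    ... | yes eq = contradiction (inj eq) λ ()
    ... | no _   = refl
    rest : sum (λ j → if does (x ≟ᵛ y (suc j)) then g (y (suc j)) else 0ℚ) ≡ 0ℚ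
    rest = trans (sum-cong-≗ other) (trans (sum-const k 0ℚ) (ℚ.*-zeroʳ (ℕ→ℚ k)))
  ... | no _ = subst (_≤ g x) (sym (ℚ.+-identityˡ _))
    (points≤ (y ∘ suc) (Fin.suc-injective ∘ inj) x)

  -- Taking expectations in `points≤` bounds the cost of an order from below by the contribution of
  -- the spikes alone.
  ∑Pr≤𝔼 : ∀ p → ProbabilityVector p → ∀ {k} (y : Fin k → Input n) → (∀ {i j} → y i ≡ y j → i ≡ j) →
          sum (λ j → Pr p (y j) * g (y j)) ≤ 𝔼 p g
  ∑Pr≤𝔼 p pv {k} y inj = begin
    sum (λ j → Pr p (y j) * g (y j))
      ≡⟨ sum-cong-≗ {k} (λ j → 𝔼-point p (y j) (g (y j))) ⟨
    sum (λ j → 𝔼 p (λ x → if does (x ≟ᵛ y j) then g (y j) else 0ℚ))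
      ≡⟨ 𝔼-sum p (λ j x → if does (x ≟ᵛ y j) then g (y j) else 0ℚ) ⟨
    𝔼 p (λ x → sum (λ j → if does (x ≟ᵛ y j) then g (y j) else 0ℚ))
      ≤⟨ 𝔼-mono p pv (points≤ y inj) ⟩
    𝔼 p g ∎
    where open ℚ.≤-Reasoning

-- Bernoulli's inequality for the probability of a point

weight : ℚ → Bool → ℚ
weight q b = if b then q else 1ℚ - q

-- The two sides differ by `w * (e * S)`. The factor `w` is 1 in `bernoulli` and the weight of the
-- exempt coordinate in `bernoulli-except`.
bernoulli-step : ∀ w {e S} → 0ℚ ≤ w → 0ℚ ≤ e → 0ℚ ≤ S → w * (1ℚ - (e + S)) ≤ (1ℚ - e) * (w * (1ℚ - S))
bernoulli-step w {e} {S} 0≤w 0≤e 0≤S = ≤-+ʳ (0≤* 0≤w (0≤* 0≤e 0≤S))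
  (solve 3 (λ w e S → w :* (con 1ℚ :- (e :+ S)) :+ w :* (e :* S)
       := (con 1ℚ :- e) :* (w :* (con 1ℚ :- S))) refl w e S)

bernoulli : ∀ {n} (p : Vec ℚ n) x (e : Fin n → ℚ) → (∀ i → 0ℚ ≤ e i) → (∀ i → e i ≤ 1ℚ) →
            (∀ i → weight (lookup p i) (lookup x i) ≡ 1ℚ - e i) → 1ℚ - sum e ≤ Pr p x
bernoulli []      []      e 0≤e e≤1 eq = ℚ.≤-refl
bernoulli (q ∷ p) (b ∷ x) e 0≤e e≤1 eq = begin
  1ℚ - (e zero + S)             ≡⟨ ℚ.*-identityˡ _ ⟨
  1ℚ * (1ℚ - (e zero + S))
    ≤⟨ bernoulli-step 1ℚ (ℚ.<⇒≤ (ℚ.positive⁻¹ 1ℚ)) (0≤e zero) (0≤sum (0≤e ∘ suc)) ⟩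
  (1ℚ - e zero) * (1ℚ * (1ℚ - S)) ≡⟨ cong ((1ℚ - e zero) *_) (ℚ.*-identityˡ _) ⟩
  (1ℚ - e zero) * (1ℚ - S)
    ≤⟨ *-monoˡ (0≤1- (e≤1 zero)) (bernoulli p x (e ∘ suc) (0≤e ∘ suc) (e≤1 ∘ suc) (eq ∘ suc)) ⟩
  (1ℚ - e zero) * Pr p x        ≡⟨ cong (_* Pr p x) (eq zero) ⟨
  weight q b * Pr p x           ∎
  where
  open ℚ.≤-Reasoning
  S = sum (e ∘ suc)

-- Here coordinate `v` may have any nonnegative weight, which is kept as a factor. The sum still
-- includes `e v`, which only weakens the bound and spares a sum with one index left out.
bernoulli-except : ∀ {n} (p : Vec ℚ n) x (e : Fin n → ℚ) v → (∀ i → 0ℚ ≤ e i) → (∀ i → e i ≤ 1ℚ) →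
                   (∀ i → i ≢ v → weight (lookup p i) (lookup x i) ≡ 1ℚ - e i) →
                   0ℚ ≤ weight (lookup p v) (lookup x v) →
                   weight (lookup p v) (lookup x v) * (1ℚ - sum e) ≤ Pr p x
bernoulli-except (q ∷ p) (b ∷ x) e zero 0≤e e≤1 eq 0≤w = *-monoˡ 0≤w (begin
  1ℚ - (e zero + S)
    ≤⟨ ≤-+ʳ (0≤e zero) (solve 2 (λ a S → (con 1ℚ :- (a :+ S)) :+ a
         := con 1ℚ :- S) refl (e zero) S) ⟩
  1ℚ - S             ≤⟨ bernoulli p x (e ∘ suc) (0≤e ∘ suc) (e≤1 ∘ suc) (λ i → eq (suc i) λ ()) ⟩
  Pr p x             ∎)
  where
  open ℚ.≤-Reasoning
  S = sum (e ∘ suc)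
bernoulli-except (q ∷ p) (b ∷ x) e (suc v) 0≤e e≤1 eq 0≤w = begin
  w * (1ℚ - (e zero + S))        ≤⟨ bernoulli-step w 0≤w (0≤e zero) (0≤sum (0≤e ∘ suc)) ⟩
  (1ℚ - e zero) * (w * (1ℚ - S))
    ≤⟨ *-monoˡ (0≤1- (e≤1 zero)) (bernoulli-except p x (e ∘ suc) v (0≤e ∘ suc) (e≤1 ∘ suc)
         (λ i i≢v → eq (suc i) (i≢v ∘ Fin.suc-injective)) 0≤w) ⟩
  (1ℚ - e zero) * Pr p x         ≡⟨ cong (_* Pr p x) (eq zero λ ()) ⟨
  weight q b * Pr p x            ∎
  where
  open ℚ.≤-Reasoning
  S = sum (e ∘ suc)
  w = weight (lookup p v) (lookup x v)

-- The formula and the adaptive strategy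

module _ {A : Set} (P : A → Bool) where

  all-tabulate-true : ∀ {k} (f : Fin k → A) → (∀ i → P (f i) ≡ true) → all P (List.tabulate f) ≡ true
  all-tabulate-true {zero}  f eq = refl
  all-tabulate-true {suc k} f eq = cong₂ _∧_ (eq zero) (all-tabulate-true (f ∘ suc) (eq ∘ suc))

  all-tabulate-false : ∀ {k} (f : Fin k → A) i → P (f i) ≡ false → all P (List.tabulate f) ≡ false
  all-tabulate-false f zero    eq rewrite eq = refl
  all-tabulate-false f (suc i) eq = trans
    (cong (P (f zero) ∧_) (all-tabulate-false (f ∘ suc) i eq)) (∧-zeroʳ (P (f zero)))

  any-tabulate-true : ∀ {k} (f : Fin k → A) i → P (f i) ≡ true → any P (List.tabulate f) ≡ true
  any-tabulate-true f zero    eq rewrite eq = refl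
  any-tabulate-true f (suc i) eq = trans
    (cong (P (f zero) ∨_) (any-tabulate-true (f ∘ suc) i eq)) (∨-zeroʳ (P (f zero)))

  any-tabulate-false : ∀ {k} (f : Fin k → A) → (∀ i → P (f i) ≡ false) → any P (List.tabulate f) ≡ false
  any-tabulate-false {zero}  f eq = refl
  any-tabulate-false {suc k} f eq = cong₂ _∨_ (eq zero) (any-tabulate-false (f ∘ suc) (eq ∘ suc))

module _ {A : Set} {P Q : A → Bool} where

  all-tabulate-cong : ∀ {k} (f : Fin k → A) → (∀ i → P (f i) ≡ Q (f i)) →
                      all P (List.tabulate f) ≡ all Q (List.tabulate f)
  all-tabulate-cong {zero}  f eq = refl
  all-tabulate-cong {suc k} f eq = cong₂ _∧_ (eq zero) (all-tabulate-cong (f ∘ suc) (eq ∘ suc))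

  any-tabulate-cong : ∀ {k} (f : Fin k → A) → (∀ i → P (f i) ≡ Q (f i)) →
                      any P (List.tabulate f) ≡ any Q (List.tabulate f)
  any-tabulate-cong {zero}  f eq = refl
  any-tabulate-cong {suc k} f eq = cong₂ _∨_ (eq zero) (any-tabulate-cong (f ∘ suc) (eq ∘ suc))

-- (m²/16) / (5m/4) = m/20.
gapConstant : ℚ
gapConstant = ℤ.1ℤ ℚ./ 20

module Construction (k : ℕ) where

  m n : ℕ
  m = suc k
  n = m ℕ.* m

  pivot : Fin m → Fin n
  pivot j = combine j zero

  literal : Fin m → Fin m → Literal n
  literal j i = pos (combine j i)

  -- With the head split off like this, `List⁺.toList (term j)` reduces to
  -- `List.tabulate (literal j)`, so lemmas on tabulated lists apply directly. The same holds for
  -- `formula`.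
  term : Fin m → Term n
  term j = literal j zero ∷ List.tabulate (literal j ∘ suc)

  formula : DNF n
  formula = term zero ∷ List.tabulate (term ∘ suc)

  f : BoolFun n
  f = ⟦ formula ⟧

  ∈-vars : ∀ {v j} → v ∈ vars (term j) → ∃[ i ] v ≡ combine j i
  ∈-vars {v} {j} v∈ = ∈-tabulate⁻ (subst (v ∈_) (map-tabulate (literal j) var) v∈)

  readOnce : ReadOnce formula
  readOnce =
    All.tabulate⁺ (λ j → All.tabulate⁺ {f = literal j} (λ i → isPos (combine j i))) ,
    AllPairs.tabulate⁺ {f = term} disjoint
    where
    disjoint : ∀ {j j′} → j ≢ j′ → Disjoint (vars (term j)) (vars (term j′))
    disjoint {j} {j′} j≢j′ (v∈ , v∈′) with ∈-vars {j = j} v∈ | ∈-vars {j = j′} v∈′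
    ... | i , refl | i′ , eq = j≢j′ (Fin.combine-injectiveˡ j i j′ i′ eq)

  -- The two ways in which the strategy finishes with a term: a false pivot falsifies it, and
  -- otherwise all its variables get known.
  Resolved : Knowledge n → Fin m → Set
  Resolved ρ j = lookup ρ (pivot j) ≡ just false ⊎ (∀ i → Known ρ (combine j i))

  resolved-⊑ : ∀ ρ ρ′ {j} → ρ ⊑ ρ′ → Resolved ρ j → Resolved ρ′ j
  resolved-⊑ ρ ρ′ ext (inj₁ eq)    = inj₁ (ext _ eq)
  resolved-⊑ ρ ρ′ ext (inj₂ known) = inj₂ λ i → proj₁ (known i) , ext _ (proj₂ (known i))

  resolved⇒determined : ∀ ρ → (∀ j → Resolved ρ j) → Determined f ρ
  resolved⇒determined ρ resolved x x′ a a′ = any-tabulate-cong term same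
    where
    same : ∀ j → evalTerm (term j) x′ ≡ evalTerm (term j) x
    same j with resolved j
    ... | inj₁ eq = trans
      (all-tabulate-false (λ l → evalLiteral l x′) (literal j) zero (agrees-lookup ρ x′ a′ eq))
      (sym (all-tabulate-false (λ l → evalLiteral l x) (literal j) zero (agrees-lookup ρ x a eq)))
    ... | inj₂ known = all-tabulate-cong (literal j) λ i →
      trans (agrees-lookup ρ x′ a′ (proj₂ (known i))) (sym (agrees-lookup ρ x a (proj₂ (known i))))

  -- A true pivot is charged `m` rather than `m - 1`: the whole term is then passed to `testAll`,
  -- and the pivot counts again although it is skipped.
  budget : List (Fin m) → Input n → ℕ
  budget []       x = 0
  budget (j ∷ js) x = suc ((if lookup x (pivot j) then m else 0) ℕ.+ budget js x)

  -- The hypothesis is a loop invariant: each term is still on the list `js` or already resolved.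
  -- Once `js` is empty, every term is resolved and `f` is determined.
  solveTerms : ∀ js {ρ} → (∀ j → j ∈ js ⊎ Resolved ρ j) → TreeWithin f ρ (budget js)
  solveTerms [] {ρ} inv = stop (resolved⇒determined ρ resolved) , λ _ _ → z≤n
    where
    resolved : ∀ j → Resolved ρ j
    resolved j with inv j
    ... | inj₂ r = r
  solveTerms (j ∷ js) {ρ} inv =
    testAll f (pivot j ∷ []) λ { ext ((b , eq) ∷ []) → afterPivot b eq ext }
    where
    continue : ∀ {ρ′} → ρ ⊑ ρ′ → Resolved ρ′ j → TreeWithin f ρ′ (budget js)
    continue {ρ′} ext r = solveTerms js inv′
      where
      inv′ : ∀ j′ → j′ ∈ js ⊎ Resolved ρ′ j′
      inv′ j′ with inv j′
      ... | inj₁ (here refl) = inj₂ r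
      ... | inj₁ (there j∈)  = inj₁ j∈
      ... | inj₂ r′          = inj₂ (resolved-⊑ ρ ρ′ {j′} ext r′)

    afterPivot : ∀ b {ρ′} → lookup ρ′ (pivot j) ≡ just b → ρ ⊑ ρ′ →
                 TreeWithin f ρ′ (λ x → (if lookup x (pivot j) then m else 0) ℕ.+ budget js x)
    afterPivot false {ρ′} eq ext with continue ext (inj₁ eq)
    ... | t , bound = t , λ x a → ℕ.≤-trans (bound x a) (ℕ.m≤n+m _ _)
    afterPivot true {ρ′} eq ext
      with testAll f (List.tabulate (combine j)) {ρ′} {budget js} (λ ext′ known →
             continue (λ i e → ext′ i (ext i e)) (inj₂ (All.tabulate⁻ known)))
    -- The input agrees with `ρ′`, so its pivot is true and the charge is `m`, the length of the
    -- list of tests.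
    ... | t , bound = t , λ x a → subst (treeLength t x ℕ.≤_)
      (cong (ℕ._+ budget js x)
        (trans (length-tabulate (combine {m} {m} j)) (cong (if_then m else 0) (sym (agrees-lookup ρ′ x a eq)))))
      (bound x a)

  pivotsFirst : TreeWithin f noTests (budget (List.allFin m))
  pivotsFirst = solveTerms (List.allFin m) (λ j → inj₁ (∈-allFin j))

  -- Spikes

  onPairs : {A : Set} → (Fin m → Fin m → A) → Fin n → A
  onPairs h v = h (proj₁ (remQuot {m} m v)) (proj₂ (remQuot {m} m v))

  onPairs-combine : {A : Set} (h : Fin m → Fin m → A) → ∀ j i → onPairs h (combine j i) ≡ h j i
  onPairs-combine h j i = cong (λ ji → h (proj₁ ji) (proj₂ ji)) (Fin.remQuot-combine j i)

  spikeBit : Fin m → Fin m → Fin m → Bool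
  spikeBit j t zero    = does (t Fin.≟ j)
  spikeBit j t (suc _) = true

  spike : Fin m → Input n
  spike j = Vec.tabulate (onPairs (spikeBit j))

  lookup-spike : ∀ j t i → lookup (spike j) (combine t i) ≡ spikeBit j t i
  lookup-spike j t i =
    trans (lookup∘tabulate (onPairs (spikeBit j)) (combine t i)) (onPairs-combine (spikeBit j) t i)

  spike-term : ∀ j i → lookup (spike j) (combine j i) ≡ true
  spike-term j zero    = trans (lookup-spike j j zero) (dec-true (j Fin.≟ j) refl)
  spike-term j (suc i) = lookup-spike j j (suc i)

  spike-pivot : ∀ {j t} → t ≢ j → lookup (spike j) (pivot t) ≡ false
  spike-pivot {j} {t} t≢j = trans (lookup-spike j t zero) (dec-false (t Fin.≟ j) t≢j)

  spike-injective : ∀ {i j} → spike i ≡ spike j → i ≡ j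
  spike-injective {i} {j} eq with i Fin.≟ j
  ... | yes i≡j = i≡j
  ... | no  i≢j = contradiction
    (trans (sym (spike-term i zero)) (trans (cong (λ x → lookup x (pivot i)) eq) (spike-pivot i≢j)))
    λ ()

  spike-true : ∀ j → f (spike j) ≡ true
  spike-true j = any-tabulate-true (λ t → evalTerm t (spike j)) term j
    (all-tabulate-true (λ l → evalLiteral l (spike j)) (literal j) (spike-term j))

  -- Term `j` loses the flipped variable. Every other term stays false because of its own pivot,
  -- which the flip does not touch.
  spike-flip-false : ∀ j i → f (spike j [ combine j i ]≔ false) ≡ false
  spike-flip-false j i = any-tabulate-false (λ t → evalTerm t x) term falsified
    where
    x = spike j [ combine j i ]≔ false
    falsified : ∀ t → evalTerm (term t) x ≡ false
    falsified t with t Fin.≟ j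
    ... | yes refl = all-tabulate-false (λ l → evalLiteral l x) (literal j) i
      (lookup∘update (combine j i) (spike j) false)
    ... | no t≢j = all-tabulate-false (λ l → evalLiteral l x) (literal t) zero
      (trans (lookup∘update′ (t≢j ∘ Fin.combine-injectiveˡ t zero j i) (spike j) false)
             (spike-pivot t≢j))

  spike-critical : ∀ j i → f (spike j [ combine j i ]≔ false) ≢ f (spike j)
  spike-critical j i eq =
    contradiction (trans (sym (spike-flip-false j i)) (trans eq (spike-true j))) λ ()

  -- The probability vector and the likelihood of spikes

  M q ε : ℚ
  M = ℕ→ℚ m
  private
    instance
      4m-positive : ℚ.Positive (ℕ→ℚ (4 ℕ.* m))
      4m-positive = ℚ.normalize-pos (4 ℕ.* m) 1
      4m-nonZero : ℚ.NonZero (ℕ→ℚ (4 ℕ.* m))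
      4m-nonZero = ℚ.pos⇒nonZero (ℕ→ℚ (4 ℕ.* m))
  q = ℚ.1/ ℕ→ℚ (4 ℕ.* m)
  ε = ℕ→ℚ 4 * q * q  -- = 1/(4m²), as 4 q m = 1

  4qM≡1 : ℕ→ℚ 4 * q * M ≡ 1ℚ
  4qM≡1 = begin
    ℕ→ℚ 4 * q * M          ≡⟨ solve 3 (λ a b c → a :* b :* c := b :* (a :* c)) refl (ℕ→ℚ 4) q M ⟩
    q * (ℕ→ℚ 4 * M)        ≡⟨ cong (q *_) (ℕ→ℚ-* 4 m) ⟨
    q * ℕ→ℚ (4 ℕ.* m)      ≡⟨ ℚ.*-inverseˡ (ℕ→ℚ (4 ℕ.* m)) ⟩
    1ℚ                     ∎
    where open ≡-Reasoning

  0<q : 0ℚ < q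
  0<q = ℚ.positive⁻¹ q {{ℚ.1/pos⇒pos (ℕ→ℚ (4 ℕ.* m))}}

  0≤q : 0ℚ ≤ q
  0≤q = ℚ.<⇒≤ 0<q

  1≤M : 1ℚ ≤ M
  1≤M = ℕ→ℚ-mono-≤ {1} {m} (s≤s z≤n)

  4q≤1 : ℕ→ℚ 4 * q ≤ 1ℚ
  4q≤1 = begin
    ℕ→ℚ 4 * q         ≡⟨ ℚ.*-identityʳ _ ⟨
    ℕ→ℚ 4 * q * 1ℚ    ≤⟨ *-monoˡ (0≤* (0≤ℕ→ℚ 4) 0≤q) 1≤M ⟩
    ℕ→ℚ 4 * q * M     ≡⟨ 4qM≡1 ⟩
    1ℚ                ∎
    where open ℚ.≤-Reasoning

  q<1 : q < 1ℚ
  q<1 = begin-strict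
    q                        ≡⟨ ℚ.+-identityʳ q ⟨
    q + 0ℚ                   <⟨ ℚ.+-monoʳ-< q 0<q ⟩
    q + q
      ≤⟨ ≤-+ʳ (0≤+ 0≤q 0≤q) (solve 1 (λ q → (q :+ q) :+ (q :+ q) := con (ℕ→ℚ 4) :* q) refl q) ⟩
    ℕ→ℚ 4 * q                ≤⟨ 4q≤1 ⟩
    1ℚ                       ∎
    where open ℚ.≤-Reasoning

  ε≤q : ε ≤ q
  ε≤q = subst₂ _≤_ (ℚ.*-comm q (ℕ→ℚ 4 * q)) (ℚ.*-identityʳ q) (*-monoˡ 0≤q 4q≤1)

  0<ε : 0ℚ < ε
  0<ε = ℚ.positive⁻¹ ε {{ℚ.pos*pos⇒pos (ℕ→ℚ 4 * q) {{ℚ.pos*pos⇒pos (ℕ→ℚ 4) q {{q⁺}}}} q {{q⁺}}}}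
    where q⁺ = ℚ.positive 0<q

  ε<1 : ε < 1ℚ
  ε<1 = ℚ.≤-<-trans ε≤q q<1

  1-ε-bounds : 0ℚ < 1ℚ - ε × 1ℚ - ε < 1ℚ
  1-ε-bounds = subst (_< 1ℚ - ε) (ℚ.+-inverseʳ ε) (ℚ.+-monoˡ-< (ℚ.- ε) ε<1) ,
               ℚ.+-monoʳ-< 1ℚ (ℚ.neg-antimono-< 0<ε)

  prob : Fin m → Fin m → ℚ
  prob _ zero    = q
  prob _ (suc _) = 1ℚ - ε

  p : Vec ℚ n
  p = Vec.tabulate (onPairs prob)

  lookup-p : ∀ j i → lookup p (combine j i) ≡ prob j i
  lookup-p j i = trans (lookup∘tabulate (onPairs prob) (combine j i)) (onPairs-combine prob j i)

  probabilities : ProbabilityVector p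
  probabilities v rewrite lookup∘tabulate (onPairs prob) v with proj₂ (remQuot {m} m v)
  ... | zero  = 0<q , q<1
  ... | suc _ = 1-ε-bounds

  -- The probability of the unusual value: true for a pivot, false for any other variable. Thus
  -- `spike j` is unusual at pivot `j` only.
  deficit : Fin m → Fin m → ℚ
  deficit _ zero    = q
  deficit _ (suc _) = ε

  deficit-bounds : ∀ v → 0ℚ ≤ onPairs deficit v × onPairs deficit v ≤ 1ℚ
  deficit-bounds v with proj₂ (remQuot {m} m v)
  ... | zero  = 0≤q , ℚ.<⇒≤ q<1
  ... | suc _ = ℚ.<⇒≤ 0<ε , ℚ.<⇒≤ ε<1

  sum-deficit : sum (onPairs deficit) ≤ ½
  sum-deficit = begin
    sum (onPairs deficit)
      ≡⟨ sum-combine m (onPairs deficit) ⟩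
    sum {m} (λ j → sum {m} (λ i → onPairs deficit (combine j i)))
      ≡⟨ sum-cong-≗ {m} (λ j → sum-cong-≗ {m} (onPairs-combine deficit j)) ⟩
    sum {m} (λ _ → q + sum {k} (λ _ → ε))
      ≡⟨ trans (sum-const m (q + sum {k} (λ _ → ε))) (cong (λ z → M * (q + z)) (sum-const k ε)) ⟩
    M * (q + ℕ→ℚ k * ε)
      -- Rounding the `k` non-pivots of a term up to `m` makes the sum a polynomial in `4 q M`.
      ≤⟨ *-monoˡ (0≤ℕ→ℚ m) (ℚ.+-monoʳ-≤ q
           (ℚ.*-monoʳ-≤-nonNeg ε {{ℚ.nonNegative (ℚ.<⇒≤ 0<ε)}} (ℕ→ℚ-mono-≤ (ℕ.n≤1+n k)))) ⟩
    M * (q + M * ε)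
      -- With `u = 4 q M`, the pivots contribute `u/4` and the other variables `u²/4`; both are 1/4
      -- since `u = 1`.
      ≡⟨ solve 2 (λ M q → M :* (q :+ M :* (con (ℕ→ℚ 4) :* q :* q))
           := con (½ * ½) :* ((con (ℕ→ℚ 4) :* q :* M) :+ (con (ℕ→ℚ 4) :* q :* M) :* (con (ℕ→ℚ 4) :* q :* M))) refl M q ⟩
    ½ * ½ * (ℕ→ℚ 4 * q * M + (ℕ→ℚ 4 * q * M) * (ℕ→ℚ 4 * q * M))
      ≡⟨ cong (λ u → ½ * ½ * (u + u * u)) 4qM≡1 ⟩
    ½ ∎
    where open ℚ.≤-Reasoning

  -- Pivot `j` contributes the factor `q`; by Bernoulli's inequality the remaining coordinates cost
  -- at most a factor 1/2.
  spike-likely : ∀ j → q * ½ ≤ Pr p (spike j)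
  spike-likely j = begin
    q * ½
      ≤⟨ *-monoˡ 0≤q (ℚ.+-monoʳ-≤ 1ℚ (ℚ.neg-antimono-≤ sum-deficit)) ⟩
    q * (1ℚ - sum (onPairs deficit))         ≡⟨ cong (_* (1ℚ - sum (onPairs deficit))) spiked ⟨
    weight (lookup p (pivot j)) (lookup (spike j) (pivot j)) * (1ℚ - sum (onPairs deficit))
      ≤⟨ bernoulli-except p (spike j) (onPairs deficit) (pivot j)
           (proj₁ ∘ deficit-bounds) (proj₂ ∘ deficit-bounds) expected (subst (0ℚ ≤_) (sym spiked) 0≤q) ⟩
    Pr p (spike j)                           ∎
    where
    open ℚ.≤-Reasoning
    spiked : weight (lookup p (pivot j)) (lookup (spike j) (pivot j)) ≡ q
    spiked = cong₂ weight (lookup-p j zero) (spike-term j zero)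
    expected : ∀ v → v ≢ pivot j → weight (lookup p v) (lookup (spike j) v) ≡ 1ℚ - onPairs deficit v
    expected v v≢ with Fin.combine-surjective {m} {m} v
    ... | t , suc i , refl = trans (cong₂ weight (lookup-p t (suc i)) (lookup-spike j t (suc i)))
      (cong (1ℚ -_) (sym (onPairs-combine deficit t (suc i))))
    ... | t , zero , refl = trans (cong₂ weight (lookup-p t zero) (spike-pivot {j} {t} (v≢ ∘ cong pivot)))
      (cong (1ℚ -_) (sym (onPairs-combine deficit t zero)))

  -- Expected cost of the adaptive strategy

  -- Linearity of expectation: each listed term costs one test, plus `m` more with probability `q`.
  𝔼-budget : ∀ js → 𝔼 p (ℕ→ℚ ∘ budget js) ≡ ℕ→ℚ (length js) * (1ℚ + q * M)
  𝔼-budget []       = trans (𝔼-const p 0ℚ) (sym (ℚ.*-zeroˡ (1ℚ + q * M)))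
  𝔼-budget (j ∷ js) = begin
    𝔼 p (ℕ→ℚ ∘ budget (j ∷ js))
      ≡⟨ 𝔼-cong p split ⟩
    𝔼 p (λ x → 1ℚ + (alive x + ℕ→ℚ (budget js x)))
      ≡⟨ trans (𝔼-+ p (λ _ → 1ℚ) (λ x → alive x + ℕ→ℚ (budget js x)))
               (cong₂ _+_ (𝔼-const p 1ℚ) (𝔼-+ p alive (ℕ→ℚ ∘ budget js))) ⟩
    1ℚ + (𝔼 p alive + 𝔼 p (ℕ→ℚ ∘ budget js))
      ≡⟨ cong₂ (λ a b → 1ℚ + (a + b)) (trans (𝔼-if p (pivot j) M) (cong (_* M) (lookup-p j zero))) (𝔼-budget js) ⟩
    1ℚ + (q * M + ℕ→ℚ (length js) * (1ℚ + q * M))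
      ≡⟨ solve 2 (λ a l → con 1ℚ :+ (a :+ l :* (con 1ℚ :+ a))
           := (con 1ℚ :+ l) :* (con 1ℚ :+ a)) refl (q * M) (ℕ→ℚ (length js)) ⟩
    (1ℚ + ℕ→ℚ (length js)) * (1ℚ + q * M)
      ≡⟨ cong (_* (1ℚ + q * M)) (ℕ→ℚ-+ 1 (length js)) ⟨
    ℕ→ℚ (suc (length js)) * (1ℚ + q * M) ∎
    where
    open ≡-Reasoning
    alive : Input n → ℚ
    alive x = if lookup x (pivot j) then M else 0ℚ
    split : ∀ x → ℕ→ℚ (budget (j ∷ js) x) ≡ 1ℚ + (alive x + ℕ→ℚ (budget js x))
    split x with lookup x (pivot j)
    ... | true  = trans (ℕ→ℚ-+ 1 (m ℕ.+ budget js x)) (cong (1ℚ +_) (ℕ→ℚ-+ m (budget js x)))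
    ... | false = trans (ℕ→ℚ-+ 1 (budget js x)) (cong (1ℚ +_) (sym (ℚ.+-identityˡ (ℕ→ℚ (budget js x)))))

  adaptive-cost : costᴬ f (unitCosts n) p (proj₁ pivotsFirst) ≤ M * (1ℚ + q * M)
  adaptive-cost = begin
    𝔼 p (treeCost (unitCosts n) (proj₁ pivotsFirst))
      ≡⟨ 𝔼-cong p (treeCost-unit (proj₁ pivotsFirst)) ⟩
    𝔼 p (ℕ→ℚ ∘ treeLength (proj₁ pivotsFirst))
      ≤⟨ 𝔼-mono p probabilities (λ x → ℕ→ℚ-mono-≤ (proj₂ pivotsFirst x (agrees-noTests x))) ⟩
    𝔼 p (ℕ→ℚ ∘ budget (List.allFin m))
      ≡⟨ 𝔼-budget (List.allFin m) ⟩
    ℕ→ℚ (length (List.allFin m)) * (1ℚ + q * M)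
      ≡⟨ cong (λ l → ℕ→ℚ l * (1ℚ + q * M)) (length-tabulate {n = m} (λ i → i)) ⟩
    M * (1ℚ + q * M) ∎
    where open ℚ.≤-Reasoning

  -- Lower bound for every testing order

  module _ (π : NonAdaptiveStrategy n) where

    tests : Input n → ℕ
    tests = orderLength f noTests (List.tabulate (π ⟨$⟩ʳ_))

    π-injective : ∀ {i j} → π ⟨$⟩ʳ i ≡ π ⟨$⟩ʳ j → i ≡ j
    π-injective eq = trans (sym (inverseˡ π)) (trans (cong (π ⟨$⟩ˡ_) eq) (inverseˡ π))

    -- The argument of `tests` is the spike of the term containing the variable at position `l`, and
    -- that variable is critical for it.
    spike-tests : ∀ l → toℕ l ℕ.< tests (onPairs (λ j _ → spike j) (π ⟨$⟩ʳ l))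
    spike-tests l with Fin.combine-surjective {m} {m} (π ⟨$⟩ʳ l)
    ... | j , i , eq = subst (λ x → toℕ l ℕ.< tests x)
      (trans (sym (onPairs-combine (λ j _ → spike j) j i)) (cong (onPairs (λ j _ → spike j)) eq))
      (orderLength-critical (π ⟨$⟩ʳ_) π-injective l noTests false (agrees-noTests (spike j))
        (lookup-replicate (π ⟨$⟩ʳ l) nothing)
        (subst (λ v → f (spike j [ v ]≔ false) ≢ f (spike j)) eq (spike-critical j i)))

    spikeTests : ℚ
    spikeTests = sum (λ j → ℕ→ℚ (tests (spike j)))

    -- Double counting: `spike-tests` is summed over all `n = m * m` positions, and both sides are
    -- doubled to match `triangular`.
    spikes-costly : (M * M) * (M * M) ≤ M * spikeTests + M * spikeTests
    spikes-costly = begin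
      (M * M) * (M * M)      ≡⟨ cong (λ z → z * z) (ℕ→ℚ-* m m) ⟨
      ℕ→ℚ n * ℕ→ℚ n          ≤⟨ ≤-+ʳ (0≤ℕ→ℚ n) (sym (triangular n)) ⟩
      T + T                  ≤⟨ ℚ.+-mono-≤ T≤ T≤ ⟩
      M * spikeTests + M * spikeTests          ∎
      where
      open ℚ.≤-Reasoning
      T = sum {n} (λ l → ℕ→ℚ (suc (toℕ l)))
      cost : Fin n → ℚ
      cost v = ℕ→ℚ (tests (onPairs (λ j _ → spike j) v))
      T≤ : T ≤ M * spikeTests
      T≤ = begin
        T
          ≤⟨ sum-mono {n} (λ l → ℕ→ℚ-mono-≤ (spike-tests l)) ⟩
        -- Reindexing by `π` passes from positions to variables; each spike is then counted once for
        -- each of the `m` variables of its term.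
        sum (λ l → cost (π ⟨$⟩ʳ l))                        ≡⟨ sum-permute cost π ⟨
        sum cost                                           ≡⟨ sum-combine m cost ⟩
        sum {m} (λ j → sum {m} (λ i → cost (combine j i)))
          ≡⟨ sum-cong-≗ {m} (λ j → sum-cong-≗ {m} (λ i → cong (ℕ→ℚ ∘ tests) (onPairs-combine (λ j _ → spike j) j i))) ⟩
        sum {m} (λ j → sum {m} (λ _ → ℕ→ℚ (tests (spike j))))
          ≡⟨ sum-cong-≗ {m} (λ j → sum-const m (ℕ→ℚ (tests (spike j)))) ⟩
        sum {m} (λ j → M * ℕ→ℚ (tests (spike j)))
          ≡⟨ *-distribˡ-sum M (λ j → ℕ→ℚ (tests (spike j))) ⟨
        M * spikeTests                                              ∎

    nonadaptive-cost : (q * ½) * spikeTests ≤ costᴺ f (unitCosts n) p π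
    nonadaptive-cost = begin
      (q * ½) * spikeTests
        ≡⟨ *-distribˡ-sum (q * ½) (λ j → ℕ→ℚ (tests (spike j))) ⟩
      sum (λ j → (q * ½) * ℕ→ℚ (tests (spike j)))
        ≤⟨ sum-mono {m} (λ j → ℚ.*-monoʳ-≤-nonNeg (ℕ→ℚ (tests (spike j)))
           {{ℚ.nonNegative (0≤ℕ→ℚ (tests (spike j)))}} (spike-likely j)) ⟩
      sum (λ j → Pr p (spike j) * ℕ→ℚ (tests (spike j)))
        ≤⟨ ∑Pr≤𝔼 (ℕ→ℚ ∘ tests) (0≤ℕ→ℚ ∘ tests) p probabilities spike spike-injective ⟩
      𝔼 p (ℕ→ℚ ∘ tests)
        ≡⟨ 𝔼-cong p (orderCost-unit f noTests (List.tabulate (π ⟨$⟩ʳ_))) ⟨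
      costᴺ f (unitCosts n) p π ∎
      where open ℚ.≤-Reasoning

  -- Comparison of the two bounds

  -- Both sides are multiplied by `M`, because `spikes-costly` bounds `M * spikeTests`; the factor
  -- is cancelled at the end.
  gap : ∀ π {a} → a ≤ M * (1ℚ + q * M) → gapConstant * M * a ≤ costᴺ f (unitCosts n) p π
  gap π {a} a≤ = ℚ.*-cancelˡ-≤-pos M {{ℚ.normalize-pos m 1}} (begin
    M * (gapConstant * M * a)
      ≤⟨ *-monoˡ 0≤M (*-monoˡ (0≤* (ℚ.<⇒≤ (ℚ.positive⁻¹ gapConstant)) 0≤M) a≤) ⟩
    M * (gapConstant * M * (M * (1ℚ + q * M)))
      -- Writing 1 as `4 q M` turns `1 + q M` into `5 q M`, and 5/20 is the factor `½ * ½` of the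
      -- next line.
      ≡⟨ cong (λ u → M * (gapConstant * M * (M * (u + q * M)))) 4qM≡1 ⟨
    M * (gapConstant * M * (M * (ℕ→ℚ 4 * q * M + q * M)))
      ≡⟨ solve 2 (λ M q → M :* (con gapConstant :* M :* (M :* (con (ℕ→ℚ 4) :* q :* M :+ q :* M)))
           := q :* con (½ * ½) :* ((M :* M) :* (M :* M))) refl M q ⟩
    q * (½ * ½) * ((M * M) * (M * M))
      ≤⟨ *-monoˡ (0≤* 0≤q (ℚ.<⇒≤ (ℚ.positive⁻¹ (½ * ½)))) (spikes-costly π) ⟩
    q * (½ * ½) * (M * spikeTests π + M * spikeTests π)
      ≡⟨ solve 3 (λ M q G → q :* con (½ * ½) :* (M :* G :+ M :* G)
           := M :* (q :* con ½ :* G)) refl M q (spikeTests π) ⟩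
    M * (q * ½ * spikeTests π)
      ≤⟨ *-monoˡ 0≤M (nonadaptive-cost π) ⟩
    M * costᴺ f (unitCosts n) p π ∎)
    where
    open ℚ.≤-Reasoning
    0≤M = 0≤ℕ→ℚ m

theorem4 : Σ[ c₀ ∈ ℚ ] Σ[ n₀ ∈ ℕ ] 0ℚ < c₀ ×
    ((n √n : ℕ) → n ≥ℕ n₀ → √n *ℕ √n ≡ n → 2 ∣ √n →
    Σ[ φ ∈ DNF n ] Σ[ p ∈ Vec ℚ n ] ReadOnce φ × ProbabilityVector p ×
    (Σ[ optᴺ ∈ ℚ ] Σ[ optᴬ ∈ ℚ ]
    IsOPTᴺ ⟦ φ ⟧ (unitCosts n) p optᴺ × IsOPTᴬ ⟦ φ ⟧ (unitCosts n) p optᴬ ×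
    optᴺ ≥ c₀ * ℕ→ℚ √n * optᴬ))
-- The threshold 1 excludes `√n = 0`, so that `√n` has the form `suc k` required by `Construction`.
theorem4 = gapConstant , 1 , ℚ.positive⁻¹ gapConstant , construct
  where
  construct : (n √n : ℕ) → n ≥ℕ 1 → √n *ℕ √n ≡ n → 2 ∣ √n →
    Σ[ φ ∈ DNF n ] Σ[ p ∈ Vec ℚ n ] ReadOnce φ × ProbabilityVector p ×
    (Σ[ optᴺ ∈ ℚ ] Σ[ optᴬ ∈ ℚ ]
    IsOPTᴺ ⟦ φ ⟧ (unitCosts n) p optᴺ × IsOPTᴬ ⟦ φ ⟧ (unitCosts n) p optᴬ ×
    optᴺ ≥ gapConstant * ℕ→ℚ √n * optᴬ)
  construct _ zero    ()  refl _
  construct _ (suc k) _   refl _ =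
    let open Construction k
        (optᴺ , isOptᴺ@((π , cost≡) , _)) = optᴺ-exists f (unitCosts n) p
        (optᴬ , isOptᴬ) = optᴬ-exists (unitCosts n) p (proj₁ pivotsFirst)
    in formula , p , readOnce , probabilities , optᴺ , optᴬ , isOptᴺ , isOptᴬ ,
       -- The bound for all orders is applied to an optimal `π`, whose cost is `optᴺ`; `optᴬ` is at
       -- most the cost of `pivotsFirst`.
       subst (gapConstant * M * optᴬ ≤_) cost≡
         (gap π (ℚ.≤-trans (proj₂ isOptᴬ (proj₁ pivotsFirst)) adaptive-cost))
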